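{- Let $T$ be a $\Delta(1,2,2)$-free tournament. Then one of the following holds: (1) $T$ is isomorphic to a basic tournament; (2) $T$ is obtained from a transitive tournament by reversing the edges of vertex-disjoint directed paths; (3) $T$ contains a homogeneous set $X$ such that $T[X]$ is isomorphic to $T_5$ or $P_7$; or (4) $T$ contains a homogeneous pair $(D_1,D_2)$ such that $T[D_1\cup D_2]$ is isomorphic to $P_7^-$ and $(D_1,D_2)$ is the degree partition of this subtournament.
   Context: Tournaments are finite orientations of complete graphs; $T[X]$ is the subtournament induced on $X$, and $T\setminus X$ is $T[V(T)\setminus X]$. $T$ is $S$-free if no induced subtournament is isomorphic to $S$. For disjoint nonempty $X,Y$, $X\Rightarrow Y$ means every edge between $X$ and $Y$ is directed from $X$ to $Y$. $\Delta(1,2,2)$ is the tournament on $\{x,y_1,y_2,z_1,z_2\}$ with $x\Rightarrow\{y_1,y_2\}\Rightarrow\{z_1,z_2\}\Rightarrow x$ and edges $y_1y_2$, $z_1z_2$. $T_5$ has vertices $v_1,\dots,v_5$ with $v_iv_j\in E$ iff $j-i\equiv1,2\pmod 5$. $P_7$ has vertices $v_1,\dots,v_7$ with $v_iv_j\in E$ iff $j-i\equiv 1,2,4\pmod 7$. $P_7^-$ is $P_7$ with one vertex deleted (well defined up to isomorphism). The basic tournaments are $T_5,P_7^-,P_7$. The degree partition of $P_7^-$ is $(D_1,D_2)$ where $D_1$ is the set of vertices of out-degree $3$ and $D_2$ the set of vertices of out-degree $2$ in $P_7^-$. A nonempty $X\subseteq V(T)$ is a homogeneous set if every $v\in V(T)\setminus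 X$ satisfies $v\Rightarrow X$ or $X\Rightarrow v$. For nonempty disjoint $A_1,A_2$, $(A_1,A_2)$ is a homogeneous pair if $A_1$ is a homogeneous set of $T\setminus A_2$ and $A_2$ is a homogeneous set of $T\setminus A_1$. -}

module Defs where

open import Data.Nat using (ℕ; zero; suc; _+_; _∸_; _≟_)
open import Data.Nat.DivMod using (_%_)
open import Data.Fin using (Fin; toℕ; inject₁)
open import Data.Fin.Subset using (Subset; ⊤; _∈_; _∉_; _∪_; Nonempty; Empty)
open import Data.Bool using (Bool; true; false; not; _∨_; if_then_else_)
open import Data.List using (List; []; _∷_; concat; length; filter)
open import Data.List.Membership.Propositional using () renaming (_∈_ to _∈ˡ_)
open import Data.List.Relation.Unary.Unique.Propositional using (Unique)
open import Data.List.Relation.Unary.Any using (Any)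
open import Data.Product using (Σ; ∃; _×_; _,_)
open import Data.Sum using (_⊎_)
open import Function using (Injective)
open import Relation.Nullary using (¬_; does)
open import Relation.Binary.PropositionalEquality using (_≡_; _≢_)
open import Data.Vec.Functional using (Vector)
import Data.Vec.Functional as VF

-- A digraph on vertex set Fin n, given by its adjacency (true = edge u → v).
Adj : ℕ → Set
Adj n = Fin n → Fin n → Bool

record Tournament (n : ℕ) : Set where
  field
    adj     : Adj n
    irrefl  : ∀ i → adj i i ≡ false
    oneEdge : ∀ i j → i ≢ j → not (adj i j) ≡ adj j i
open Tournament public

record IsoOnto {m n : ℕ} (S : Adj m) (T : Adj n) (X : Subset n) (f : Fin m → Fin n) : Set where
  field
    inj   : Injective _≡_ _≡_ f
    into  : ∀ i → f i ∈ X
    onto  : ∀ x → x ∈ X → ∃ λ i → f i ≡ x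
    edges : ∀ i j → S i j ≡ T (f i) (f j)

InducedIso : {m n : ℕ} → Adj n → Subset n → Adj m → Set
InducedIso {m} {n} T X S = Σ (Fin m → Fin n) λ f → IsoOnto S T X f

full : ∀ {n} → Subset n
full = ⊤

Isomorphic : {m n : ℕ} → Adj n → Adj m → Set
Isomorphic T S = InducedIso T full S

Contains : {m n : ℕ} → Adj n → Adj m → Set
Contains {m} {n} T S = Σ (Fin m → Fin n) λ f →
  Injective _≡_ _≡_ f × (∀ i j → S i j ≡ T (f i) (f j))

Free : {m n : ℕ} → Adj m → Adj n → Set
Free S T = ¬ Contains T S

-- Δ(1,2,2): x = 0, y₁ = 1, y₂ = 2, z₁ = 3, z₂ = 4;
-- x ⇒ {y₁,y₂} ⇒ {z₁,z₂} ⇒ x, and edges y₁y₂, z₁z₂.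
Δ122 : Adj 5
Δ122 i j = edge (toℕ i) (toℕ j)
  where
  edge : ℕ → ℕ → Bool
  edge 0 1 = true
  edge 0 2 = true
  edge 1 3 = true
  edge 1 4 = true
  edge 2 3 = true
  edge 2 4 = true
  edge 3 0 = true
  edge 4 0 = true
  edge 1 2 = true
  edge 3 4 = true
  edge _ _ = false

memℕ : ℕ → List ℕ → Bool
memℕ d [] = false
memℕ d (k ∷ ks) = does (d ≟ k) ∨ memℕ d ks

-- circulant tournament: v_i v_j is an edge iff (j - i) mod p ∈ S
circ : (p : ℕ) → List ℕ → Adj p
circ p S i j = memℕ ((toℕ j + p ∸ toℕ i) % suc (p ∸ 1)) S

-- T₅ (vertices v₁..v₅ represented by 0..4)
T5 : Adj 5
T5 = circ 5 (1 ∷ 2 ∷ [])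

-- P₇ (vertices v₁..v₇ represented by 0..6)
P7 : Adj 7
P7 = circ 7 (1 ∷ 2 ∷ 4 ∷ [])

P7⁻ : Adj 6
P7⁻ i j = P7 (inject₁ i) (inject₁ j)

outdeg : {n : ℕ} → Adj n → Fin n → ℕ
outdeg {n} T v = VF.foldr (λ b k → if b then suc k else k) 0 (T v)

_⇒ˢ_ : {n : ℕ} → (T : Adj n) → Fin n → Subset n → Set
_⇒ˢ_ T v X = ∀ x → x ∈ X → T v x ≡ true

_ˢ⇒_ : {n : ℕ} → (T : Adj n) → Subset n → Fin n → Set
_ˢ⇒_ T X v = ∀ x → x ∈ X → T x v ≡ true

Homogeneous : {n : ℕ} → Adj n → Subset n → Set
Homogeneous T X = Nonempty X × (∀ v → v ∉ X → (T ⇒ˢ v) X ⊎ (T ˢ⇒ X) v)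

HomogeneousPair : {n : ℕ} → Adj n → Subset n → Subset n → Set
HomogeneousPair T A₁ A₂ =
  Nonempty A₁ × Nonempty A₂ × (∀ v → v ∈ A₁ → v ∉ A₂) ×
  (∀ v → v ∉ A₁ → v ∉ A₂ → (T ⇒ˢ v) A₁ ⊎ (T ˢ⇒ A₁) v) ×
  (∀ v → v ∉ A₁ → v ∉ A₂ → (T ⇒ˢ v) A₂ ⊎ (T ˢ⇒ A₂) v)

P7⁻WithDegreePartition : {n : ℕ} → Adj n → Subset n → Subset n → Set
P7⁻WithDegreePartition {n} T D₁ D₂ = Σ (Fin 6 → Fin n) λ f →
  IsoOnto P7⁻ T (D₁ ∪ D₂) f ×
  (∀ i → outdeg P7⁻ i ≡ 3 → f i ∈ D₁) ×
  (∀ i → outdeg P7⁻ i ≡ 2 → f i ∈ D₂) ×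
  (∀ x → x ∈ D₁ → ∃ λ i → f i ≡ x × outdeg P7⁻ i ≡ 3) ×
  (∀ x → x ∈ D₂ → ∃ λ i → f i ≡ x × outdeg P7⁻ i ≡ 2)

data Consec {A : Set} : List A → A → A → Set where
  here  : ∀ {x y xs} → Consec (x ∷ y ∷ xs) x y
  there : ∀ {z xs x y} → Consec xs x y → Consec (z ∷ xs) x y

Transitive : {n : ℕ} → Tournament n → Set
Transitive T' = ∀ a b c → adj T' a b ≡ true → adj T' b c ≡ true → adj T' a c ≡ true

IsDirectedPath : {n : ℕ} → Adj n → List (Fin n) → Set
IsDirectedPath T' p = (p ≢ []) × (∀ u v → Consec p u v → T' u v ≡ true)

PathEdge : {n : ℕ} → List (List (Fin n)) → Fin n → Fin n → Set
PathEdge ps u v = Any (λ p → Consec p u v) ps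

ReversedPathsOfTransitive : {n : ℕ} → Tournament n → Set
ReversedPathsOfTransitive {n} T =
  Σ (Tournament n) λ T' → Σ (List (List (Fin n))) λ ps →
    Transitive T' ×
    (∀ p → p ∈ˡ ps → IsDirectedPath (adj T') p) ×
    Unique (concat ps) ×
    (∀ u v → (adj T u v ≡ true →
                 (adj T' u v ≡ true × ¬ PathEdge ps u v) ⊎ PathEdge ps v u) ×
             (((adj T' u v ≡ true × ¬ PathEdge ps u v) ⊎ PathEdge ps v u) →
                 adj T u v ≡ true))

{-# OPTIONS --safe #-}

-- A vertex attached to a copy of T₅ in a Δ(1,2,2)-free tournament sees it homogeneously, and one attached
-- to a copy of P₇⁻ sees each of D₁ and D₂ homogeneously (the vertex completing P₇ included): a finite check.
-- So a copy of T₅ or P₇⁻ gives (3) or (4), even if it is all of T, and (1) is never needed.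
--
-- If T contains neither, it has an ordering in which every vertex has at most one earlier out-neighbour and
-- at most one later in-neighbour, so that the backward edges form disjoint paths. By induction on the number
-- of vertices:
-- * Some w has out-degree at most 1. Otherwise the last vertex in an ordering of T \ v has exactly two
--   out-neighbours, one of them v; so every vertex v is dominated by a vertex of out-degree 2. Walking
--   backwards gives a cyclic triangle of such vertices, and the three remaining edges leaving that triangle
--   produce Δ(1,2,2), T₅ or P₇⁻.
-- * In an ordering of T \ w, let x be the out-neighbour of w. If a later y beats x, then x has only one
--   out-neighbour that beats y, so at most one vertex c lies between x and y. Exchanging x and y, or
--   rotating the block x c y, leaves x without later in-neighbour, and w can be put last.
module Submission where

open import Defs
open import Data.Bool using (Bool; true; false; not)
open import Data.Bool.Properties using (not-¬; ¬-not) renaming (_≟_ to _≟ᵇ_)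
open import Data.Empty using (⊥; ⊥-elim)
open import Data.Fin using (Fin; zero; suc; _≟_)
open import Data.Fin.Properties using (any?; all?)
open import Data.Fin.Subset using (Subset; _∪_; _∈_; _∉_)
open import Data.Fin.Subset.Properties using (anySubset?; x∈p∪q⁺; x∈p∪q⁻)
open import Data.List using (List; []; _∷_; [_]; _++_; concat; length; filter; allFin; cartesianProduct; initLast; _∷ʳ′_)
open import Data.List.Membership.Propositional using (lose) renaming (_∈_ to _∈ˡ_; _∉_ to _∉ˡ_)
open import Data.List.Membership.Propositional.Properties using (∈-∃++; ∈-allFin; ∈-filter⁺; ∈-cartesianProduct⁺; ∈-++⁺ˡ; ∈-++⁺ʳ; ∈-++⁻)
open import Data.List.Properties using (++-assoc; length-tabulate)
open import Data.List.Relation.Binary.Permutation.Propositional using (_↭_; ↭-refl; ↭-sym; ↭-trans; ↭-prep; ↭-swap; ↭⇒↭ₛ)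
open import Data.List.Relation.Binary.Permutation.Propositional.Properties using (∈-resp-↭; ↭-length; shift; ++⁺ˡ; ∷↭∷ʳ)
open import Data.List.Relation.Unary.All as All using (All; []; _∷_)
open import Data.List.Relation.Unary.AllPairs using ([]; _∷_)
open import Data.List.Relation.Unary.Any using (here; there)
open import Data.List.Relation.Unary.Unique.Propositional using (Unique)
open import Data.List.Relation.Unary.Unique.Propositional.Properties using (allFin⁺)
open import Data.Nat as ℕ using (ℕ; suc)
open import Data.Nat.Properties using (suc-injective)
open import Data.Product using (Σ; ∃; ∃₂; _×_; _,_; proj₁; proj₂)
open import Data.Sum as Sum using (_⊎_; inj₁; inj₂; [_,_]′)
open import Data.Unit using (⊤; tt)
open import Data.Vec using (Vec; []; _∷_; lookup; tabulate)
open import Data.Vec.Properties using (lookup∘tabulate; lookup⇒[]=; []=⇒lookup)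
open import Function using (_∘_; id; Injective)
open import Relation.Binary.PropositionalEquality using (_≡_; _≢_; refl; sym; trans; cong; cong₂; subst; ≢-sym; setoid)
open import Relation.Nullary using (¬_; Dec; yes; no; does; ¬?; _×-dec_; _⊎-dec_; _→-dec_; contradiction)
open import Relation.Nullary.Decidable using (map′; True; toWitness; decidable-stable; dec-true; dec-false; from-yes)
open import Relation.Unary using (Decidable)
import Data.List.Membership.DecPropositional as DecMembership
import Data.List.Relation.Binary.Permutation.Setoid.Properties as Permutationₛ

-- Embeddings of small tournaments and their one-vertex extensions

Emb : {m n : ℕ} → Adj m → Adj n → Set
Emb {m} {n} S T = Σ (Fin m → Fin n) λ f → ∀ i j → S i j ≡ T (f i) (f j)

-- Backtracking search: C i x says that x is still allowed as the image of i.
embWithin? : {m n : ℕ} (S : Adj m) (T : Adj n) {C : Fin m → Fin n → Set} →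
  (∀ i x → Dec (C i x)) → Dec (Σ (Emb S T) λ f → ∀ i → C i (proj₁ f i))
embWithin? {ℕ.zero} S T C? = yes (((λ ()) , λ ()) , λ ())
embWithin? {suc m} {n} S T {C} C? = map′ join split (any? λ x →
    (C? zero x ×-dec (S zero zero ≟ᵇ T x x)) ×-dec
    embWithin? S′ T (λ i y → C? (suc i) y ×-dec
      ((S zero (suc i) ≟ᵇ T x y) ×-dec (S (suc i) zero ≟ᵇ T y x))))
  where
  S′ : Adj m
  S′ i j = S (suc i) (suc j)
  C′ : Fin n → Fin m → Fin n → Set
  C′ x i y = C (suc i) y × (S zero (suc i) ≡ T x y) × (S (suc i) zero ≡ T y x)
  join : (∃ λ x → (C zero x × S zero zero ≡ T x x) ×
            Σ (Emb S′ T) λ f → ∀ i → C′ x i (proj₁ f i)) →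
         Σ (Emb S T) λ f → ∀ i → C i (proj₁ f i)
  join (x , (cx , ex) , (f , e) , c) = (g , eg) , cg
    where
    g : Fin (suc m) → Fin n
    g zero = x
    g (suc i) = f i
    eg : ∀ i j → S i j ≡ T (g i) (g j)
    eg zero zero = ex
    eg zero (suc j) = proj₁ (proj₂ (c j))
    eg (suc i) zero = proj₂ (proj₂ (c i))
    eg (suc i) (suc j) = e i j
    cg : ∀ i → C i (g i)
    cg zero = cx
    cg (suc i) = proj₁ (c i)
  split : (Σ (Emb S T) λ f → ∀ i → C i (proj₁ f i)) →
          ∃ λ x → (C zero x × S zero zero ≡ T x x) ×
            Σ (Emb S′ T) λ f → ∀ i → C′ x i (proj₁ f i)
  split ((f , e) , c) = f zero , (c zero , e zero zero) ,
    (f ∘ suc , λ i j → e (suc i) (suc j)) ,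
    λ i → c (suc i) , e zero (suc i) , e (suc i) zero

emb? : {m n : ℕ} (S : Adj m) (T : Adj n) → Dec (Emb S T)
emb? S T = map′ proj₁ (λ f → f , λ _ → tt) (embWithin? S T {λ _ _ → ⊤} λ _ _ → yes tt)

oneEdge? : {n : ℕ} (S : Adj n) → Dec (∀ i j → i ≢ j → not (S i j) ≡ S j i)
oneEdge? S = all? λ i → all? λ j → ¬? (i ≟ j) →-dec (not (S i j) ≟ᵇ S j i)

tournament : {n : ℕ} (S : Adj n) → True (all? λ i → S i i ≟ᵇ false) → True (oneEdge? S) → Tournament n
tournament S irr one = record { adj = S ; irrefl = toWitness irr ; oneEdge = toWitness one }

Δ122ᵗ : Tournament 5
Δ122ᵗ = tournament Δ122 tt tt

T5ᵗ : Tournament 5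
T5ᵗ = tournament T5 tt tt

P7⁻ᵗ : Tournament 6
P7⁻ᵗ = tournament P7⁻ tt tt

-- Two distinct vertices with one image would have equal entries in both directions, which `oneEdge`
-- forbids.
emb-injective : {m n : ℕ} (S : Tournament m) (T : Adj n) (f : Emb (adj S) T) →
  Injective _≡_ _≡_ (proj₁ f)
emb-injective S T (f , e) {i} {j} fi≡fj with i ≟ j
... | yes i≡j = i≡j
... | no i≢j = ⊥-elim (not-¬ (trans (e i j) (trans (cong₂ T fi≡fj (sym fi≡fj)) (sym (e j i))))
                              (sym (oneEdge S j i (≢-sym i≢j))))

emb⇒contains : {m n : ℕ} (S : Tournament m) (T : Adj n) → Emb (adj S) T → Contains T (adj S)
emb⇒contains S T (f , e) = f , (λ {i} {j} → emb-injective S T (f , e) {i} {j}) , e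

-- S with a new vertex zero, which beats i exactly when p says so.
ext : {m : ℕ} → Adj m → Vec Bool m → Adj (suc m)
ext S p zero zero = false
ext S p zero (suc j) = lookup p j
ext S p (suc i) zero = not (lookup p i)
ext S p (suc i) (suc j) = S i j

Constant : {m : ℕ} → Vec Bool m → (Fin m → Set) → Set
Constant p Q = (∀ i → Q i → lookup p i ≡ true) ⊎ (∀ i → Q i → lookup p i ≡ false)

-- `Q` singles out the part towards which the new vertex must be uniform, so that the two degree
-- classes of `P7⁻` can be tested separately.
Rigid : {m : ℕ} → Adj m → (Fin m → Set) → Set
Rigid {m} S Q = (p : Vec Bool m) → Constant p Q ⊎ Emb Δ122 (ext S p)

rigid? : {m : ℕ} (S : Adj m) {Q : Fin m → Set} → Decidable Q → Dec (Rigid S Q)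
rigid? S Q? = map′ (λ none p → decidable-stable (good? p) (λ bad → none (p , bad)))
                   (λ r (p , bad) → bad (r p))
                   -- A subset is a `Vec Bool m`, so the search over subsets runs through all
                   -- attachment patterns.
                   (¬? (anySubset? (¬? ∘ good?)))
  where
  good? = λ p → ((all? λ i → Q? i →-dec (lookup p i ≟ᵇ true)) ⊎-dec
                 (all? λ i → Q? i →-dec (lookup p i ≟ᵇ false))) ⊎-dec
                emb? Δ122 (ext S p)

-- Abstract, since unfolding these proofs would rerun the search.
abstract

  T5-rigid : Rigid T5 λ _ → ⊤
  T5-rigid = from-yes (rigid? T5 λ _ → yes tt)

  P7⁻-rigid₃ : Rigid P7⁻ λ i → outdeg P7⁻ i ≡ 3
  P7⁻-rigid₃ = from-yes (rigid? P7⁻ λ i → outdeg P7⁻ i ℕ.≟ 3)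

  P7⁻-rigid₂ : Rigid P7⁻ λ i → outdeg P7⁻ i ≡ 2
  P7⁻-rigid₂ = from-yes (rigid? P7⁻ λ i → outdeg P7⁻ i ℕ.≟ 2)

-- The order is lexicographic; the lists of arcs given to `emb-from-arcs` follow it.
arcs : {m : ℕ} → Adj m → List (Fin m × Fin m)
arcs {m} S = filter (λ ij → S (proj₁ ij) (proj₂ ij) ≟ᵇ true) (cartesianProduct (allFin m) (allFin m))

-- Positions in lists without repetition

module _ {A : Set} where

  Unique-resp-↭ : {xs ys : List A} → xs ↭ ys → Unique xs → Unique ys
  Unique-resp-↭ = Permutationₛ.Unique-resp-↭ (setoid A) ∘ ↭⇒↭ₛ

  head∉tail : ∀ {x} {xs : List A} → Unique (x ∷ xs) → x ∉ˡ xs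
  head∉tail (x≢ ∷ _) x∈ = All.lookup x≢ x∈ refl

  tail-unique : ∀ {x} {xs : List A} → Unique (x ∷ xs) → Unique xs
  tail-unique (_ ∷ uq) = uq

  data Before : List A → A → A → Set where
    here  : ∀ {u v xs} → v ∈ˡ xs → Before (u ∷ xs) u v
    there : ∀ {x u v xs} → Before xs u v → Before (x ∷ xs) u v

  before-∈ˡ : ∀ {xs u v} → Before xs u v → u ∈ˡ xs
  before-∈ˡ (here _) = here refl
  before-∈ˡ (there b) = there (before-∈ˡ b)

  before-∈ʳ : ∀ {xs u v} → Before xs u v → v ∈ˡ xs
  before-∈ʳ (here v∈) = there v∈
  before-∈ʳ (there b) = there (before-∈ʳ b)

  before-++⁻ : ∀ xs {ys u v} → Before (xs ++ ys) u v →
    Before xs u v ⊎ (u ∈ˡ xs × v ∈ˡ ys) ⊎ Before ys u v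
  before-++⁻ [] b = inj₂ (inj₂ b)
  before-++⁻ (x ∷ xs) (here v∈) with ∈-++⁻ xs v∈
  ... | inj₁ v∈xs = inj₁ (here v∈xs)
  ... | inj₂ v∈ys = inj₂ (inj₁ (here refl , v∈ys))
  before-++⁻ (x ∷ xs) (there b) with before-++⁻ xs b
  ... | inj₁ b′ = inj₁ (there b′)
  ... | inj₂ (inj₁ (u∈ , v∈)) = inj₂ (inj₁ (there u∈ , v∈))
  ... | inj₂ (inj₂ b′) = inj₂ (inj₂ b′)

  before-++⁺ˡ : ∀ {xs ys u v} → Before xs u v → Before (xs ++ ys) u v
  before-++⁺ˡ (here v∈) = here (∈-++⁺ˡ v∈)
  before-++⁺ˡ (there b) = there (before-++⁺ˡ b)

  before-++⁺ʳ : ∀ xs {ys u v} → Before ys u v → Before (xs ++ ys) u v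
  before-++⁺ʳ [] b = b
  before-++⁺ʳ (x ∷ xs) b = there (before-++⁺ʳ xs b)

  before-across : ∀ {xs ys u v} → u ∈ˡ xs → v ∈ˡ ys → Before (xs ++ ys) u v
  before-across {x ∷ xs} (here refl) v∈ = here (∈-++⁺ʳ xs v∈)
  before-across (there u∈) v∈ = there (before-across u∈ v∈)

  -- Rearranging a block creates new ordered pairs only inside the block. This compares back edges
  -- before and after an exchange or a rotation.
  before-block : ∀ xs {ys ys′ zs u v} → (∀ {w} → w ∈ˡ ys′ → w ∈ˡ ys) →
    Before (xs ++ ys′ ++ zs) u v → Before (xs ++ ys ++ zs) u v ⊎ Before ys′ u v
  before-block xs {ys} {ys′} sub b with before-++⁻ xs b
  ... | inj₁ b′ = inj₁ (before-++⁺ˡ b′)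
  ... | inj₂ (inj₁ (u∈ , v∈)) = inj₁ (before-across u∈
          ([ ∈-++⁺ˡ ∘ sub , ∈-++⁺ʳ ys ]′ (∈-++⁻ ys′ v∈)))
  ... | inj₂ (inj₂ b′) with before-++⁻ ys′ b′
  ...   | inj₁ b″ = inj₂ b″
  ...   | inj₂ (inj₁ (u∈ , v∈)) = inj₁ (before-++⁺ʳ xs (before-across (sub u∈) v∈))
  ...   | inj₂ (inj₂ b″) = inj₁ (before-++⁺ʳ xs (before-++⁺ʳ ys b″))

  before-asym : ∀ {xs u v} → Unique xs → Before xs u v → ¬ Before xs v u
  before-asym uq (here v∈) (here _) = head∉tail uq v∈
  before-asym uq (here _) (there b) = head∉tail uq (before-∈ʳ b)
  before-asym uq (there b) (here _) = head∉tail uq (before-∈ʳ b)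
  before-asym uq (there b) (there b′) = before-asym (tail-unique uq) b b′

  before-irrefl : ∀ {xs u v} → Unique xs → Before xs u v → u ≢ v
  before-irrefl uq b refl = before-asym uq b b

  before-trans : ∀ {xs u v w} → Unique xs → Before xs u v → Before xs v w → Before xs u w
  before-trans uq (here _) (here w∈) = here w∈
  before-trans uq (here _) (there b) = here (before-∈ʳ b)
  before-trans uq (there b) (here _) = ⊥-elim (head∉tail uq (before-∈ʳ b))
  before-trans uq (there b) (there b′) = there (before-trans (tail-unique uq) b b′)

  before-total : ∀ {xs u v} → u ∈ˡ xs → v ∈ˡ xs → u ≢ v → Before xs u v ⊎ Before xs v u
  before-total (here refl) (here refl) u≢v = contradiction refl u≢v
  before-total (here refl) (there v∈) _ = inj₁ (here v∈)
  before-total (there u∈) (here refl) _ = inj₂ (here u∈)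
  before-total (there u∈) (there v∈) u≢v = Sum.map there there (before-total u∈ v∈ u≢v)

  after-∈ : ∀ xs {ys u v} → Unique (xs ++ u ∷ ys) → Before (xs ++ u ∷ ys) u v → v ∈ˡ ys
  after-∈ [] uq (here v∈) = v∈
  after-∈ [] uq (there b) = ⊥-elim (head∉tail uq (before-∈ˡ b))
  after-∈ (x ∷ xs) uq (here _) = ⊥-elim (head∉tail uq (∈-++⁺ʳ xs (here refl)))
  after-∈ (x ∷ xs) uq (there b) = after-∈ xs (tail-unique uq) b

  prior-∈ : ∀ xs {ys u v} → Unique (xs ++ v ∷ ys) → Before (xs ++ v ∷ ys) u v → u ∈ˡ xs
  prior-∈ [] uq (here v∈) = ⊥-elim (head∉tail uq v∈)
  prior-∈ [] uq (there b) = ⊥-elim (head∉tail uq (before-∈ʳ b))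
  prior-∈ (x ∷ xs) uq (here _) = here refl
  prior-∈ (x ∷ xs) uq (there b) = there (prior-∈ xs (tail-unique uq) b)

  extract : ∀ {w} {xs : List A} → w ∈ˡ xs → ∃ λ ys → xs ↭ w ∷ ys
  extract {w} w∈ with ∈-∃++ w∈
  ... | xs , ys , refl = xs ++ ys , shift w xs ys

-- Copies of small tournaments and their homogeneity

module InTournament {n : ℕ} (T : Tournament n) where

  V : Set
  V = Fin n

  infix 4 _⟶_ _⟶?_

  _⟶_ : V → V → Set
  u ⟶ v = adj T u v ≡ true

  _⟶?_ : ∀ u v → Dec (u ⟶ v)
  u ⟶? v = adj T u v ≟ᵇ true

  ⟶-irrefl : ∀ {u v} → u ⟶ v → u ≢ v
  ⟶-irrefl {u} u⟶u refl = contradiction (trans (sym u⟶u) (irrefl T u)) λ ()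

  ⟶-asym : ∀ {u v} → u ⟶ v → ¬ v ⟶ u
  ⟶-asym {u} {v} uv vu =
    contradiction (trans (cong not (sym uv)) (trans (oneEdge T u v (⟶-irrefl uv)) vu)) λ ()

  ⟶-flip : ∀ {u v} → u ≢ v → ¬ u ⟶ v → v ⟶ u
  ⟶-flip {u} {v} u≢v ¬uv = trans (sym (oneEdge T u v u≢v)) (cong not (¬-not ¬uv))

  out≢in : ∀ {x a b} → x ⟶ a → b ⟶ x → a ≢ b
  out≢in xa bx refl = ⟶-asym xa bx

  -- Between distinct vertices a non-arc of `S` is a reversed arc, whose image excludes the other
  -- direction in `T`.
  emb-from-arcs : {m : ℕ} (S : Tournament m) (f : Fin m → V) →
    All (λ ij → f (proj₁ ij) ⟶ f (proj₂ ij)) (arcs (adj S)) → Emb (adj S) (adj T)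
  emb-from-arcs {m} S f all = f , edge
    where
    fwd : ∀ i j → adj S i j ≡ true → f i ⟶ f j
    fwd i j e = All.lookup all
      (∈-filter⁺ (λ ij → adj S (proj₁ ij) (proj₂ ij) ≟ᵇ true)
        (∈-cartesianProduct⁺ (∈-allFin i) (∈-allFin j)) e)
    edge : ∀ i j → adj S i j ≡ adj T (f i) (f j)
    edge i j with adj S i j in eq
    ... | true = sym (fwd i j eq)
    ... | false with i ≟ j
    ...   | yes refl = sym (irrefl T (f i))
    ...   | no i≢j = sym (¬-not (⟶-asym (fwd j i (trans (sym (oneEdge S i j i≢j)) (cong not eq)))))

  image : {m : ℕ} {Q : Fin m → Set} → (Fin m → V) → Decidable Q → Subset n
  image f Q? = tabulate λ x → does (any? λ i → Q? i ×-dec (f i ≟ x))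

  module _ {m : ℕ} {Q : Fin m → Set} (f : Fin m → V) (Q? : Decidable Q) where

    ∈-image⁺ : ∀ i → Q i → f i ∈ image f Q?
    ∈-image⁺ i qi = lookup⇒[]= (f i) _ (trans (lookup∘tabulate _ (f i))
      (dec-true (any? λ j → Q? j ×-dec (f j ≟ f i)) (i , qi , refl)))

    ∈-image⁻ : ∀ x → x ∈ image f Q? → ∃ λ i → Q i × f i ≡ x
    ∈-image⁻ x x∈ with any? (λ j → Q? j ×-dec (f j ≟ x)) | trans (sym (lookup∘tabulate _ x)) ([]=⇒lookup x∈)
    ... | yes p | _ = p
    ... | no _ | ()

  module _ (Δ-free : ¬ Emb Δ122 (adj T)) where

    -- The extension of `S` by the adjacencies of `v` maps into `T` through `v` and `f`, so a copy
    -- of `Δ122` in it would give one in `T`.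
    rigid-homogeneous : {m : ℕ} {S : Adj m} {Q : Fin m → Set} → Rigid S Q →
      ((f , _) : Emb S (adj T)) → ∀ v → (∀ i → f i ≢ v) →
      (∀ i → Q i → v ⟶ f i) ⊎ (∀ i → Q i → f i ⟶ v)
    rigid-homogeneous {m} {S} {Q} rigid (f , e) v v∉ with rigid (tabulate λ i → adj T v (f i))
    ... | inj₁ (inj₁ c) = inj₁ λ i qi → trans (sym (lookup∘tabulate _ i)) (c i qi)
    ... | inj₁ (inj₂ c) = inj₂ λ i qi → ⟶-flip (≢-sym (v∉ i))
            λ vi → contradiction (trans (sym vi) (trans (sym (lookup∘tabulate _ i)) (c i qi))) λ ()
    ... | inj₂ (g , eg) = ⊥-elim (Δ-free (f′ ∘ g , λ i j → trans (eg i j) (e′ (g i) (g j))))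
      where
      f′ : Fin (suc m) → V
      f′ zero = v
      f′ (suc i) = f i
      e′ : ∀ i j → ext S (tabulate λ i → adj T v (f i)) i j ≡ adj T (f′ i) (f′ j)
      e′ zero zero = sym (irrefl T v)
      e′ zero (suc j) = lookup∘tabulate _ j
      e′ (suc i) zero = trans (cong not (lookup∘tabulate _ i)) (oneEdge T v (f i) (≢-sym (v∉ i)))
      e′ (suc i) (suc j) = e i j

    homogeneous-T5 : Emb T5 (adj T) →
      Σ (Subset n) λ X → Homogeneous (adj T) X × InducedIso (adj T) X T5
    homogeneous-T5 (f , e) = X , ((f zero , ∈X zero) , hom) ,
      f , record { inj = λ {i} {j} → emb-injective T5ᵗ (adj T) (f , e) {i} {j}
                 ; into = ∈X ; onto = X∋ ; edges = e }
      where
      every? : Decidable {A = Fin 5} λ _ → ⊤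
      every? _ = yes tt
      X = image f every?
      ∈X : ∀ i → f i ∈ X
      ∈X i = ∈-image⁺ f every? i tt
      X∋ : ∀ x → x ∈ X → ∃ λ i → f i ≡ x
      X∋ x x∈ with ∈-image⁻ f every? x x∈
      ... | i , _ , fi≡x = i , fi≡x
      hom : ∀ v → v ∉ X → _
      hom v v∉ with rigid-homogeneous T5-rigid (f , e) v (λ i fi≡v → v∉ (subst (_∈ X) fi≡v (∈X i)))
      ... | inj₁ h = inj₁ λ x x∈ → subst (v ⟶_) (proj₂ (X∋ x x∈)) (h _ tt)
      ... | inj₂ h = inj₂ λ x x∈ → subst (_⟶ v) (proj₂ (X∋ x x∈)) (h _ tt)

    homogeneous-P7⁻ : Emb P7⁻ (adj T) →
      Σ (Subset n) λ D₁ → Σ (Subset n) λ D₂ →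
        HomogeneousPair (adj T) D₁ D₂ × P7⁻WithDegreePartition (adj T) D₁ D₂
    homogeneous-P7⁻ (f , e) = D 3 , D 2 ,
      -- In `P7⁻` the vertices 2, 4, 5 beat the deleted vertex and keep out-degree 2; 0, 1, 3 have
      -- out-degree 3.
      ((f zero , ∈D 3 zero refl) , (f (suc (suc zero)) , ∈D 2 (suc (suc zero)) refl) , disjoint ,
        (λ v v∉₁ v∉₂ → hom 3 P7⁻-rigid₃ v (outside v v∉₁ v∉₂)) ,
        (λ v v∉₁ v∉₂ → hom 2 P7⁻-rigid₂ v (outside v v∉₁ v∉₂))) ,
      f , record { inj = injective ; into = into ; onto = onto ; edges = e } ,
      ∈D 3 , ∈D 2 , D∋ 3 , D∋ 2
      where
      injective : Injective _≡_ _≡_ f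
      injective {i} {j} = emb-injective P7⁻ᵗ (adj T) (f , e) {i} {j}
      deg? : ∀ d → Decidable λ i → outdeg P7⁻ i ≡ d
      deg? d i = outdeg P7⁻ i ℕ.≟ d
      D : ℕ → Subset n
      D d = image f (deg? d)
      ∈D : ∀ d i → outdeg P7⁻ i ≡ d → f i ∈ D d
      ∈D d = ∈-image⁺ f (deg? d)
      D∋ : ∀ d x → x ∈ D d → ∃ λ i → f i ≡ x × outdeg P7⁻ i ≡ d
      D∋ d x x∈ with ∈-image⁻ f (deg? d) x x∈
      ... | i , di , fi≡x = i , fi≡x , di
      degrees : ∀ i → outdeg P7⁻ i ≡ 3 ⊎ outdeg P7⁻ i ≡ 2
      degrees = from-yes (all? λ i → deg? 3 i ⊎-dec deg? 2 i)
      into : ∀ i → f i ∈ D 3 ∪ D 2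
      into i = x∈p∪q⁺ (Sum.map (∈D 3 i) (∈D 2 i) (degrees i))
      onto : ∀ x → x ∈ D 3 ∪ D 2 → ∃ λ i → f i ≡ x
      onto x x∈ with x∈p∪q⁻ (D 3) (D 2) x∈
      ... | inj₁ x∈₁ = let i , fi≡x , _ = D∋ 3 x x∈₁ in i , fi≡x
      ... | inj₂ x∈₂ = let i , fi≡x , _ = D∋ 2 x x∈₂ in i , fi≡x
      disjoint : ∀ v → v ∈ D 3 → v ∉ D 2
      disjoint v v∈₁ v∈₂ with D∋ 3 v v∈₁ | D∋ 2 v v∈₂
      ... | i , fi≡v , di | j , fj≡v , dj with injective (trans fi≡v (sym fj≡v))
      ... | refl = contradiction (trans (sym di) dj) λ ()
      outside : ∀ v → v ∉ D 3 → v ∉ D 2 → ∀ i → f i ≢ v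
      outside v v∉₁ v∉₂ i refl = [ v∉₁ ∘ ∈D 3 i , v∉₂ ∘ ∈D 2 i ]′ (degrees i)
      hom : ∀ d → Rigid P7⁻ (λ i → outdeg P7⁻ i ≡ d) → ∀ v → (∀ i → f i ≢ v) →
            (adj T ⇒ˢ v) (D d) ⊎ (adj T ˢ⇒ D d) v
      hom d rigid v v∉ with rigid-homogeneous rigid (f , e) v v∉
      ... | inj₁ h = inj₁ λ x x∈ → let i , fi≡x , di = D∋ d x x∈ in subst (v ⟶_) fi≡x (h i di)
      ... | inj₂ h = inj₂ λ x x∈ → let i , fi≡x , di = D∋ d x x∈ in subst (_⟶ v) fi≡x (h i di)

  -- Orderings whose backward edges form disjoint paths

  open DecMembership (_≟_ {n}) using () renaming (_∈?_ to _∈ˡ?_)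

  before? : ∀ σ (u v : V) → Dec (Before σ u v)
  before? [] u v = no λ ()
  before? (x ∷ σ) u v = map′
    [ (λ { (refl , v∈) → here v∈ }) , there ]′
    (λ { (here v∈) → inj₁ (refl , v∈) ; (there b) → inj₂ b })
    (((x ≟ u) ×-dec (v ∈ˡ? σ)) ⊎-dec before? σ u v)

  -- Named in the direction of the reversed path, against the edge of T.
  BackEdge : List V → V → V → Set
  BackEdge σ u v = Before σ u v × v ⟶ u

  backEdge? : ∀ σ u v → Dec (BackEdge σ u v)
  backEdge? σ u v = before? σ u v ×-dec (v ⟶? u)

  -- Back edges point along the order and so close no cycle; with at most one entering and one
  -- leaving each vertex they form disjoint paths.
  record Good (σ : List V) : Set where
    field
      source-unique : ∀ {u u′ v} → BackEdge σ u v → BackEdge σ u′ v → u ≡ u′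
      target-unique : ∀ {u v v′} → BackEdge σ u v → BackEdge σ u v′ → v ≡ v′
  open Good

  good-tail : ∀ {v σ} → Good (v ∷ σ) → Good σ
  good-tail g = record
    { source-unique = λ (b , e) (b′ , e′) → source-unique g (there b , e) (there b′ , e′)
    ; target-unique = λ (b , e) (b′ , e′) → target-unique g (there b , e) (there b′ , e′) }

  forward : ∀ {σ u v} → Unique σ → Before σ u v → ¬ BackEdge σ u v → u ⟶ v
  forward uq b ¬back = ⟶-flip (≢-sym (before-irrefl uq b)) λ vu → ¬back (b , vu)

  Fresh : List V → V → V → Set
  Fresh σ p q = (∀ u → ¬ BackEdge σ u q) × (∀ v → ¬ BackEdge σ p v)

  -- A new edge from `p` to `q` is harmless if `p` had no target and `q` no source. `Fresh` sits
  -- inside the disjunct, so it is owed only when that edge occurs.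
  good-extend : ∀ {σ σ′} p q → Good σ →
    (∀ {u v} → BackEdge σ′ u v → BackEdge σ u v ⊎ (u ≡ p × v ≡ q × Fresh σ p q)) → Good σ′
  good-extend {σ} {σ′} p q g cases = record { source-unique = src ; target-unique = tgt }
    where
    src : ∀ {u u′ v} → BackEdge σ′ u v → BackEdge σ′ u′ v → u ≡ u′
    src e e′ with cases e | cases e′
    ... | inj₁ o | inj₁ o′ = source-unique g o o′
    ... | inj₁ o | inj₂ (refl , refl , noIn , _) = ⊥-elim (noIn _ o)
    ... | inj₂ (refl , refl , noIn , _) | inj₁ o′ = ⊥-elim (noIn _ o′)
    ... | inj₂ (refl , _) | inj₂ (refl , _) = refl
    tgt : ∀ {u v v′} → BackEdge σ′ u v → BackEdge σ′ u v′ → v ≡ v′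
    tgt e e′ with cases e | cases e′
    ... | inj₁ o | inj₁ o′ = target-unique g o o′
    ... | inj₁ o | inj₂ (refl , refl , _ , noOut) = ⊥-elim (noOut _ o)
    ... | inj₂ (refl , refl , _ , noOut) | inj₁ o′ = ⊥-elim (noOut _ o′)
    ... | inj₂ (_ , refl , _) | inj₂ (_ , refl , _) = refl

  -- The only possible new back edge runs from `x` to `w`: `w` is new and has no other source, and
  -- `x` has no other target.
  good-append : ∀ {σ w x} → Good σ → w ∉ˡ σ → (∀ {v} → v ∈ˡ σ → w ⟶ v → v ≡ x) →
    (∀ v → ¬ BackEdge σ x v) → Good (σ ++ [ w ])
  good-append {σ} {w} {x} g w∉ only noOut = good-extend x w g cases
    where
    cases : ∀ {u v} → BackEdge (σ ++ [ w ]) u v →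
            BackEdge σ u v ⊎ (u ≡ x × v ≡ w × Fresh σ x w)
    cases (b , vu) with before-++⁻ σ b
    ... | inj₁ b′ = inj₁ (b′ , vu)
    ... | inj₂ (inj₁ (u∈ , here refl)) =
          inj₂ (only u∈ vu , refl , (λ _ (b′ , _) → w∉ (before-∈ʳ b′)) , noOut)
    ... | inj₂ (inj₂ (here ()))
    ... | inj₂ (inj₂ (there ()))

  record Decomposition (σ : List V) : Set where
    field
      paths     : List (List V)
      covers    : concat paths ↭ σ
      nonempty  : ∀ {p} → p ∈ˡ paths → p ≢ []
      edge⇒back : ∀ {u v} → PathEdge paths u v → BackEdge σ u v
      back⇒edge : ∀ {u v} → BackEdge σ u v → PathEdge paths u v

  consec-pred : ∀ {a b : V} {p} → a ∈ˡ p → ∃ λ u → Consec (b ∷ p) u a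
  consec-pred (here refl) = _ , here
  consec-pred (there a∈) = let u , c = consec-pred a∈ in u , there c

  -- ps with v put in front of the path that starts at a.
  record Attached (v a : V) (ps : List (List V)) : Set where
    field
      paths    : List (List V)
      covers   : concat paths ↭ v ∷ concat ps
      nonempty : (∀ {p} → p ∈ˡ ps → p ≢ []) → ∀ {p} → p ∈ˡ paths → p ≢ []
      edge⁻    : ∀ {u w} → PathEdge paths u w → PathEdge ps u w ⊎ (u ≡ v × w ≡ a)
      edge⁺    : ∀ {u w} → PathEdge ps u w ⊎ (u ≡ v × w ≡ a) → PathEdge paths u w

  -- Since no path edge enters `a`, it has no predecessor on its path and must be the first vertex
  -- there.
  attach : ∀ v a ps → a ∈ˡ concat ps → (∀ u → ¬ PathEdge ps u a) → Attached v a ps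
  attach v a ([] ∷ ps) a∈ free = record
    { paths = [] ∷ paths ; covers = covers
    ; nonempty = λ ne → λ { (here refl) → ne (here refl) ; (there p∈) → nonempty (ne ∘ there) p∈ }
    ; edge⁻ = λ { (here ()) ; (there e) → Sum.map₁ there (edge⁻ e) }
    ; edge⁺ = λ { (inj₁ (here ())) ; (inj₁ (there e)) → there (edge⁺ (inj₁ e))
                ; (inj₂ eq) → there (edge⁺ (inj₂ eq)) } }
    where open Attached (attach v a ps a∈ λ u e → free u (there e))
  attach v a ((b ∷ p) ∷ ps) (here refl) free = record
    { paths = (v ∷ b ∷ p) ∷ ps ; covers = ↭-refl
    ; nonempty = λ ne → λ { (here refl) () ; (there p∈) → ne (there p∈) }
    ; edge⁻ = λ { (here here) → inj₂ (refl , refl) ; (here (there c)) → inj₁ (here c)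
                ; (there e) → inj₁ (there e) }
    ; edge⁺ = λ { (inj₁ (here c)) → here (there c) ; (inj₁ (there e)) → there e
                ; (inj₂ (refl , refl)) → here here } }
  attach v a ((b ∷ p) ∷ ps) (there a∈) free with ∈-++⁻ p a∈
  ... | inj₁ a∈p = let u , c = consec-pred a∈p in ⊥-elim (free u (here c))
  ... | inj₂ a∈ps = record
    { paths = (b ∷ p) ∷ paths
    ; covers = ↭-trans (++⁺ˡ (b ∷ p) covers) (shift v (b ∷ p) (concat ps))
    ; nonempty = λ ne → λ { (here refl) → ne (here refl) ; (there p∈) → nonempty (ne ∘ there) p∈ }
    ; edge⁻ = λ { (here c) → inj₁ (here c) ; (there e) → Sum.map₁ there (edge⁻ e) }
    ; edge⁺ = λ { (inj₁ (here c)) → here c ; (inj₁ (there e)) → there (edge⁺ (inj₁ e))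
                ; (inj₂ eq) → there (edge⁺ (inj₂ eq)) } }
    where open Attached (attach v a ps a∈ps λ u e → free u (there e))

  -- The vertex `v` precedes all of `σ`, so it can only start a path: alone, or in front of the path
  -- of its target `a`.
  decompose : ∀ σ → Unique σ → Good σ → Decomposition σ
  decompose [] _ _ = record
    { paths = [] ; covers = ↭-refl ; nonempty = λ () ; edge⇒back = λ () ; back⇒edge = λ { (() , _) } }
  decompose (v ∷ σ) uq g with any? (λ a → backEdge? (v ∷ σ) v a)
  ... | no none = record
    { paths = [ v ] ∷ paths ; covers = ↭-prep v covers
    ; nonempty = λ { (here refl) () ; (there p∈) → nonempty p∈ }
    ; edge⇒back = λ { (here (there ())) ; (there e) → let b , wu = edge⇒back e in there b , wu }
    ; back⇒edge = λ { (here w∈ , wv) → ⊥-elim (none (_ , here w∈ , wv))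
                    ; (there b , wu) → there (back⇒edge (b , wu)) } }
    where open Decomposition (decompose σ (tail-unique uq) (good-tail g))
  ... | yes (a , va@(b , av)) = record
    { paths = A.paths
    ; covers = ↭-trans A.covers (↭-prep v covers)
    ; nonempty = A.nonempty nonempty
    ; edge⇒back = λ e → [ (λ e′ → let b′ , wu = edge⇒back e′ in there b′ , wu)
                        , (λ { (refl , refl) → va }) ]′ (A.edge⁻ e)
    ; back⇒edge = λ { (here w∈ , wv) → A.edge⁺ (inj₂ (refl , target-unique g (here w∈ , wv) va))
                    ; (there b′ , wu) → A.edge⁺ (inj₁ (back⇒edge (b′ , wu))) } }
    where
    open Decomposition (decompose σ (tail-unique uq) (good-tail g))
    a∈σ : a ∈ˡ σ
    a∈σ = after-∈ [] uq b
    free : ∀ u → ¬ PathEdge paths u a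
    free u e with edge⇒back e
    -- The source of a back edge into `a` must be `v`, which does not occur in `σ`.
    ... | b′ , au with source-unique g va (there b′ , au)
    ... | refl = head∉tail uq (before-∈ˡ b′)
    module A = Attached (attach v a paths (∈-resp-↭ (↭-sym covers) a∈σ) free)

  order-tournament : ∀ {σ} → Unique σ → (∀ v → v ∈ˡ σ) → Tournament n
  order-tournament {σ} uq all∈ = record
    { adj = λ u v → does (before? σ u v)
    ; irrefl = λ u → dec-false (before? σ u u) λ b → before-asym uq b b
    ; oneEdge = one }
    where
    one : ∀ u v → u ≢ v → not (does (before? σ u v)) ≡ does (before? σ v u)
    one u v u≢v with before-total (all∈ u) (all∈ v) u≢v
    ... | inj₁ b rewrite dec-true (before? σ u v) b = sym (dec-false (before? σ v u) (before-asym uq b))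
    ... | inj₂ b rewrite dec-true (before? σ v u) b = cong not (dec-false (before? σ u v) (before-asym uq b))

  does⇒before : ∀ {σ u v} → does (before? σ u v) ≡ true → Before σ u v
  does⇒before {σ} {u} {v} eq with before? σ u v
  does⇒before eq | yes b = b
  does⇒before () | no _

  -- The transitive tournament is the order itself, and the paths to reverse come from its back
  -- edges.
  good⇒reversed-paths : ∀ {σ} → Unique σ → (∀ v → v ∈ˡ σ) → Good σ → ReversedPathsOfTransitive T
  good⇒reversed-paths {σ} uq all∈ g = order-tournament uq all∈ , paths , transitive ,
    (λ p p∈ → nonempty p∈ , λ u v c → dec-true (before? σ u v) (proj₁ (edge⇒back (lose p∈ c)))) ,
    Unique-resp-↭ (↭-sym covers) uq , λ u v → to u v , from u v
    where
    open Decomposition (decompose σ uq g)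
    transitive : Transitive (order-tournament uq all∈)
    transitive a b c ab bc = dec-true (before? σ a c)
      (before-trans uq (does⇒before {u = a} {b} ab) (does⇒before {u = b} {c} bc))
    to : ∀ u v → u ⟶ v → (does (before? σ u v) ≡ true × ¬ PathEdge paths u v) ⊎ PathEdge paths v u
    to u v uv with before-total (all∈ u) (all∈ v) (⟶-irrefl uv)
    ... | inj₁ b = inj₁ (dec-true (before? σ u v) b , λ e → ⟶-asym uv (proj₂ (edge⇒back e)))
    ... | inj₂ b = inj₂ (back⇒edge (b , uv))
    from : ∀ u v → (does (before? σ u v) ≡ true × ¬ PathEdge paths u v) ⊎ PathEdge paths v u → u ⟶ v
    from u v (inj₁ (b , ¬e)) = forward uq (does⇒before {u = u} {v} b) (¬e ∘ back⇒edge)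
    from u v (inj₂ e) = proj₂ (edge⇒back e)

  module Excluding (Δ-free : ¬ Emb Δ122 (adj T)) (T5-free : ¬ Emb T5 (adj T))
                   (P7⁻-free : ¬ Emb P7⁻ (adj T)) where

    -- Both pairs enter `Δ122` symmetrically, so each can be renamed to fit the orientation of its
    -- inner edge.
    no-Δ : ∀ {u p q r s} → p ≢ q → r ≢ s → u ⟶ p → u ⟶ q → p ⟶ r → p ⟶ s →
           q ⟶ r → q ⟶ s → r ⟶ u → s ⟶ u → ⊥
    no-Δ {u} {r = r} {s} p≢q r≢s up uq pr ps qr qs ru su = orderPQ p≢q up uq pr ps qr qs
      where
      ordered : ∀ {p q r s} → u ⟶ p → u ⟶ q → p ⟶ r → p ⟶ s → q ⟶ r → q ⟶ s →
                r ⟶ u → s ⟶ u → p ⟶ q → r ⟶ s → ⊥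
      ordered {p} {q} {r} {s} up uq pr ps qr qs ru su pq rs =
        Δ-free (emb-from-arcs Δ122ᵗ (lookup (u ∷ p ∷ q ∷ r ∷ s ∷ []))
          (up ∷ uq ∷ pq ∷ pr ∷ ps ∷ qr ∷ qs ∷ ru ∷ rs ∷ su ∷ []))
      orderRS : ∀ {p q} → u ⟶ p → u ⟶ q → p ⟶ r → p ⟶ s → q ⟶ r → q ⟶ s → p ⟶ q → ⊥
      orderRS up uq pr ps qr qs pq with r ⟶? s
      ... | yes rs = ordered up uq pr ps qr qs ru su pq rs
      ... | no ¬rs = ordered up uq ps pr qs qr su ru pq (⟶-flip r≢s ¬rs)
      orderPQ : ∀ {p q} → p ≢ q → u ⟶ p → u ⟶ q → p ⟶ r → p ⟶ s → q ⟶ r → q ⟶ s → ⊥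
      orderPQ {p} {q} p≢q up uq pr ps qr qs with p ⟶? q
      ... | yes pq = orderRS up uq pr ps qr qs pq
      ... | no ¬pq = orderRS uq up qr qs pr ps (⟶-flip p≢q ¬pq)

    -- Existence of a vertex of out-degree at most one

    TwoOuts : List V → V → Set
    TwoOuts L z = ∃₂ λ a b → a ∈ˡ L × b ∈ˡ L × z ⟶ a × z ⟶ b × a ≢ b

    record Outs (L : List V) (z a b : V) : Set where
      field
        z∈ : z ∈ˡ L
        a∈ : a ∈ˡ L
        b∈ : b ∈ˡ L
        za : z ⟶ a
        zb : z ⟶ b
        a≢b : a ≢ b
        only : ∀ {u} → u ∈ˡ L → z ⟶ u → u ≡ a ⊎ u ≡ b
    open Outs

    module _ {L : List V} where

      Outs-swap : ∀ {z a b} → Outs L z a b → Outs L z b a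
      Outs-swap o = record { z∈ = z∈ o ; a∈ = b∈ o ; b∈ = a∈ o ; za = zb o ; zb = za o
                           ; a≢b = ≢-sym (a≢b o) ; only = λ u∈ zu → Sum.swap (only o u∈ zu) }

      Outs-other : ∀ {z a b u} → Outs L z a b → u ∈ˡ L → z ⟶ u → u ≢ a → Outs L z a u
      Outs-other o u∈ zu u≢a with only o u∈ zu
      ... | inj₁ u≡a = contradiction u≡a u≢a
      ... | inj₂ refl = o

      Outs-through : ∀ {z a b u} → Outs L z a b → u ∈ˡ L → z ⟶ u → ∃ λ c → Outs L z u c
      Outs-through o u∈ zu with only o u∈ zu
      ... | inj₁ refl = _ , o
      ... | inj₂ refl = _ , Outs-swap o

      beats : ∀ {z a b u} → Outs L z a b → u ∈ˡ L → u ≢ a → u ≢ b → u ≢ z → u ⟶ z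
      beats o u∈ u≢a u≢b u≢z = ⟶-flip (≢-sym u≢z) λ zu → [ u≢a , u≢b ]′ (only o u∈ zu)

      at-most-two : ∀ {z a b p q} → Outs L z a b → p ∈ˡ L → q ∈ˡ L → p ≢ a → q ≢ a → p ≢ q →
                    z ⟶ p → z ⟶ q → ⊥
      at-most-two o p∈ q∈ p≢a q≢a p≢q zp zq with only o p∈ zp | only o q∈ zq
      ... | inj₁ p≡a | _ = p≢a p≡a
      ... | inj₂ _ | inj₁ q≡a = q≢a q≡a
      ... | inj₂ refl | inj₂ refl = p≢q refl

      -- In the cyclic order `p q z r d` each vertex beats the next two; `d` beats `p` and `q`
      -- because their out-neighbours are used up.
      no-T5 : ∀ {p q r z d} → Outs L p q z → Outs L q r z → d ∈ˡ L →
              z ⟶ r → z ⟶ d → r ⟶ p → r ⟶ d → ⊥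
      no-T5 {p} {q} {r} {z} {d} op oq d∈ zr zd rp rd =
        T5-free (emb-from-arcs T5ᵗ (lookup (p ∷ q ∷ z ∷ r ∷ d ∷ []))
          (za op ∷ zb op ∷ zb oq ∷ za oq ∷ zr ∷ zd ∷ rp ∷ rd ∷ dp ∷ dq ∷ []))
        where
        dp = beats op d∈ (out≢in zd (zb oq)) (≢-sym (⟶-irrefl zd)) (out≢in zd (zb op))
        dq = beats oq d∈ (≢-sym (⟶-irrefl rd)) (≢-sym (⟶-irrefl zd)) (out≢in zd (zb oq))

      -- p → q → r → p, and a, b, c are the ends of the only other edges leaving p, q, r.
      record Triangle (p q r a b c : V) : Set where
        constructor triangle
        field
          outp : Outs L p q a
          outq : Outs L q r b
          outr : Outs L r p c

      rotate : ∀ {p q r a b c} → Triangle p q r a b c → Triangle q r p b c a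
      rotate (triangle op oq or) = triangle oq or op

      -- If `r ⟶ d`, there is a `T5`. Otherwise `c` differs from `d`, and r ⇒ {p, c} ⇒ {q, z} ⇒ r.
      one-beaten : ∀ {p q r c z d} → Triangle p q r z z c → Outs L z r d → ⊥
      one-beaten {r = r} {d = d} (triangle op oq or) oz with r ⟶? d
      ... | yes rd = no-T5 op oq (b∈ oz) (za oz) (zb oz) (za or) rd
      ... | no ¬rd = no-Δ (a≢b or) (⟶-irrefl (zb oq)) (za or) (zb or) (za op) (zb op)
              (beats oq (b∈ or) (≢-sym (⟶-irrefl (zb or))) (out≢in (zb or) (za oz)) (out≢in (zb or) (za oq)))
              (beats oz (b∈ or) (≢-sym (⟶-irrefl (zb or)))
                (λ { refl → ¬rd (zb or) }) (out≢in (zb or) (za oz)))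
              (za oq) (za oz)

      -- Here z ⇒ {v, b} ⇒ {p, q} ⇒ z.
      all-beating : ∀ {p q r z v b} → Triangle p q r z z z → Outs L z v b → ⊥
      all-beating (triangle op oq or) oz =
        no-Δ (a≢b oz) (⟶-irrefl (za op)) (za oz) (zb oz)
          (beat op (a∈ oz) (za oz) (out≢in (za oz) (zb oq)))
          (beat oq (a∈ oz) (za oz) (out≢in (za oz) (zb or)))
          (beat op (b∈ oz) (zb oz) (out≢in (zb oz) (zb oq)))
          (beat oq (b∈ oz) (zb oz) (out≢in (zb oz) (zb or)))
          (zb op) (zb oq)
        where
        beat : ∀ {x y z v} → Outs L x y z → v ∈ˡ L → z ⟶ v → v ≢ y → v ⟶ x
        beat ox v∈ zv v≢y = beats ox v∈ v≢y (≢-sym (⟶-irrefl zv)) (out≢in zv (zb ox))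

      -- One of the two out-neighbours of `z` is `v`, outside the triangle, so at least two of `p`,
      -- `q`, `r` beat `z` and have it as their second out-neighbour.
      no-fourth : ∀ {p q r a b c z v w} → Triangle p q r a b c → Outs L z v w →
        v ≢ p → v ≢ q → v ≢ r → z ≢ p → z ≢ q → z ≢ r → ⊥
      no-fourth {p} {q} {r} {z = z} (triangle op oq or) oz v≢p v≢q v≢r z≢p z≢q z≢r
        with p ⟶? z | q ⟶? z | r ⟶? z
      ... | yes pz | yes qz | yes rz =
            all-beating (triangle (via op pz z≢q) (via oq qz z≢r) (via or rz z≢p)) oz
        where
        via : ∀ {x y a} → Outs L x y a → x ⟶ z → z ≢ y → Outs L x y z
        via o = Outs-other o (z∈ oz)
      ... | yes pz | yes qz | no ¬rz =
            one-beaten (triangle (Outs-other op (z∈ oz) pz z≢q) (Outs-other oq (z∈ oz) qz z≢r) or)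
              (Outs-swap (Outs-other oz (z∈ or) (⟶-flip (≢-sym z≢r) ¬rz) (≢-sym v≢r)))
      ... | no ¬pz | yes qz | yes rz =
            one-beaten (triangle (Outs-other oq (z∈ oz) qz z≢r) (Outs-other or (z∈ oz) rz z≢p) op)
              (Outs-swap (Outs-other oz (z∈ op) (⟶-flip (≢-sym z≢p) ¬pz) (≢-sym v≢p)))
      ... | yes pz | no ¬qz | yes rz =
            one-beaten (triangle (Outs-other or (z∈ oz) rz z≢p) (Outs-other op (z∈ oz) pz z≢q) oq)
              (Outs-swap (Outs-other oz (z∈ oq) (⟶-flip (≢-sym z≢q) ¬qz) (≢-sym v≢q)))
      ... | no ¬pz | no ¬qz | _ = at-most-two oz (z∈ op) (z∈ oq) (≢-sym v≢p) (≢-sym v≢q)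
              (⟶-irrefl (za op)) (⟶-flip (≢-sym z≢p) ¬pz) (⟶-flip (≢-sym z≢q) ¬qz)
      ... | no ¬pz | yes _ | no ¬rz = at-most-two oz (z∈ or) (z∈ op) (≢-sym v≢r) (≢-sym v≢p)
              (⟶-irrefl (za or)) (⟶-flip (≢-sym z≢r) ¬rz) (⟶-flip (≢-sym z≢p) ¬pz)
      ... | yes _ | no ¬qz | no ¬rz = at-most-two oz (z∈ oq) (z∈ or) (≢-sym v≢q) (≢-sym v≢r)
              (⟶-irrefl (za oq)) (⟶-flip (≢-sym z≢q) ¬qz) (⟶-flip (≢-sym z≢r) ¬rz)

      module _ {p q r a b c : V} (t : Triangle p q r a b c) (a≢b′ : a ≢ b) (a≢c : a ≢ c) where
        open Triangle t

        private
          a⟶q : a ⟶ q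
          a⟶q = beats outq (b∈ outp) (out≢in (zb outp) (za outr)) a≢b′ (≢-sym (a≢b outp))

          a⟶r : a ⟶ r
          a⟶r = beats outr (b∈ outp) (≢-sym (⟶-irrefl (zb outp))) a≢c (out≢in (zb outp) (za outr))

        spoke-beats : a ⟶ q × a ⟶ r
        spoke-beats = a⟶q , a⟶r

        -- The edge `a ⟶ b` would give p ⇒ {q, a} ⇒ {r, b} ⇒ p.
        spokes-reversed : b ⟶ p → b ⟶ a
        spokes-reversed bp = ⟶-flip a≢b′ λ ab →
          no-Δ (a≢b outp) (a≢b outq) (za outp) (zb outp) (za outq) (zb outq) a⟶r ab (za outr) bp

      -- All fifteen edges are forced: each spoke end beats the two triangle vertices that do not
      -- beat it, and the spoke ends form a cyclic triangle `a ⟶ c ⟶ b ⟶ a`.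
      distinct-spokes : ∀ {p q r a b c} → Triangle p q r a b c → a ≢ b → b ≢ c → c ≢ a → ⊥
      distinct-spokes {p} {q} {r} {a} {b} {c} t@(triangle op oq or) a≢b′ b≢c c≢a =
        P7⁻-free (emb-from-arcs P7⁻ᵗ (lookup (c ∷ b ∷ p ∷ a ∷ q ∷ r ∷ []))
          (cb ∷ cp ∷ cq ∷ bp ∷ ba ∷ br ∷ zb op ∷ za op ∷ ac ∷ aq ∷ ar ∷ zb oq ∷ za oq ∷ zb or ∷ za or ∷ []))
        where
        sa = spoke-beats t a≢b′ (≢-sym c≢a)
        sb = spoke-beats (rotate t) b≢c (≢-sym a≢b′)
        sc = spoke-beats (rotate (rotate t)) c≢a (≢-sym b≢c)
        aq = proj₁ sa
        ar = proj₂ sa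
        br = proj₁ sb
        bp = proj₂ sb
        cp = proj₁ sc
        cq = proj₂ sc
        ba = spokes-reversed t a≢b′ (≢-sym c≢a) bp
        cb = spokes-reversed (rotate t) b≢c (≢-sym a≢b′) cq
        ac = spokes-reversed (rotate (rotate t)) c≢a (≢-sym b≢c) ar

      module _ (two-outs : ∀ {z} → z ∈ˡ L → TwoOuts L z)
               (dominated : ∀ {v} → v ∈ˡ L → ∃₂ λ z w → Outs L z v w) where

        -- A vertex `z` of out-degree two beats `v`. As `p`, `q`, `r` do not, `z` lies outside the
        -- triangle.
        dominated-by-triangle : ∀ {p q r a b c v} → Triangle p q r a b c → v ∈ˡ L →
          v ≢ p → v ≢ q → v ≢ r → ¬ p ⟶ v → ¬ q ⟶ v → ¬ r ⟶ v → ⊥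
        dominated-by-triangle t v∈ v≢p v≢q v≢r ¬pv ¬qv ¬rv =
          let z , w , oz = dominated v∈
          in no-fourth t oz v≢p v≢q v≢r
               (λ { refl → ¬pv (za oz) }) (λ { refl → ¬qv (za oz) }) λ { refl → ¬rv (za oz) }

        out-avoiding : ∀ {d} → d ∈ˡ L → ∀ r → ∃ λ f → f ∈ˡ L × d ⟶ f × f ≢ r
        out-avoiding d∈ r with two-outs d∈
        ... | f , g , f∈ , g∈ , df , dg , f≢g with f ≟ r
        ...   | yes refl = g , g∈ , dg , ≢-sym f≢g
        ...   | no f≢r = f , f∈ , df , f≢r

        -- The vertex `d` beats some `f` other than `r`. If `f` is not `e`, no triangle vertex beats
        -- `f`; if it is, `d ⟶ r` and `d ⟶ e` complete a `T5`.
        shared-spoke : ∀ {p q r d e} → Triangle p q r d d e → ⊥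
        shared-spoke {p} {q} {r} {d} {e} t@(triangle op oq or)
          with out-avoiding (b∈ op) r
        ... | f , f∈ , df , f≢r with f ≟ e
        ...   | no f≢e = dominated-by-triangle t f∈ f≢p f≢q f≢r
                (λ pf → [ f≢q , f≢d ]′ (only op f∈ pf))
                (λ qf → [ f≢r , f≢d ]′ (only oq f∈ qf))
                (λ rf → [ f≢p , f≢e ]′ (only or f∈ rf))
          where
          f≢d = ≢-sym (⟶-irrefl df)
          f≢p = out≢in df (zb op)
          f≢q = out≢in df (zb oq)
        ...   | yes refl = no-T5 op oq (b∈ or)
                (beats or (b∈ op) (≢-sym (⟶-irrefl (zb op))) (⟶-irrefl df) (≢-sym (a≢b oq)))
                df (za or) (zb or)

        no-triangle : ∀ {p q r a b c} → Triangle p q r a b c → ⊥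
        no-triangle {a = a} {b} {c} t with a ≟ b | b ≟ c | c ≟ a
        ... | yes refl | _ | _ = shared-spoke t
        ... | no _ | yes refl | _ = shared-spoke (rotate t)
        ... | no _ | no _ | yes refl = shared-spoke (rotate (rotate t))
        ... | no a≢b′ | no b≢c | no c≢a = distinct-spokes t a≢b′ b≢c c≢a

        -- Take `z₄ ⟶ z₃ ⟶ z₂ ⟶ z₁`, each of out-degree two. If neither `z₁ ⟶ z₃` nor `z₂ ⟶ z₄`
        -- closes a triangle, `z₄` beats exactly `z₃` and `z₂`, so `z₄ ⟶ z₃ ⟶ z₁ ⟶ z₄` is one.
        all-dominated-absurd : ∀ {v} → v ∈ˡ L → ⊥
        all-dominated-absurd v∈ with dominated v∈
        ... | z₁ , _ , o₁ with dominated (z∈ o₁)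
        ... | z₂ , _ , o₂ with dominated (z∈ o₂)
        ... | z₃ , _ , o₃ with z₁ ⟶? z₃
        ... | yes z₁z₃ = no-triangle (triangle o₃ o₂ (proj₂ (Outs-through o₁ (z∈ o₃) z₁z₃)))
        ... | no ¬z₁z₃ with dominated (z∈ o₃)
        ... | z₄ , _ , o₄ with z₂ ⟶? z₄
        ... | yes z₂z₄ = no-triangle (triangle o₄ o₃ (proj₂ (Outs-through o₂ (z∈ o₄) z₂z₄)))
        ... | no ¬z₂z₄ = no-triangle (triangle o₄ (proj₂ (Outs-through o₃ (z∈ o₁) z₃z₁))
                                                 (proj₂ (Outs-through o₁ (z∈ o₄) z₁z₄)))
          where
          z₃z₁ = ⟶-flip (out≢in (za o₂) (za o₃)) ¬z₁z₃
          z₄z₂ = ⟶-flip (out≢in (za o₃) (za o₄)) ¬z₂z₄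
          z₁z₄ = beats (Outs-other o₄ (z∈ o₂) z₄z₂ (≢-sym (⟶-irrefl (za o₃)))) (z∈ o₁)
                   (≢-sym (⟶-irrefl z₃z₁)) (≢-sym (⟶-irrefl (za o₂))) (out≢in z₃z₁ (za o₄))

    -- Making x free of later in-neighbours

    Freeing : List V → V → Set
    Freeing σ x = ∃ λ σ′ → σ′ ↭ σ × Good σ′ × (∀ v → ¬ BackEdge σ′ x v)

    -- The only old target of `x` is `y`, which now precedes `x`, and the possible new back edge
    -- starts elsewhere.
    freeing-by : ∀ {σ σ′ x y} p q → Unique σ → Good σ → BackEdge σ x y → σ′ ↭ σ →
      (∀ {u v} → BackEdge σ′ u v → BackEdge σ u v ⊎ (u ≡ p × v ≡ q × Fresh σ p q)) →
      p ≢ x → Before σ′ y x → Freeing σ x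
    freeing-by {σ} {σ′} {x} p q uq g xy σ′↭σ cases p≢x yx = σ′ , σ′↭σ , good-extend p q g cases , noOut
      where
      noOut : ∀ v → ¬ BackEdge σ′ x v
      noOut v e@(b , _) with cases e
      ... | inj₂ (x≡p , _) = p≢x (sym x≡p)
      ... | inj₁ o with target-unique g o xy
      ...   | refl = before-asym (Unique-resp-↭ (↭-sym σ′↭σ) uq) yx b

    free-adjacent : ∀ α {x y γ} → let σ = α ++ x ∷ y ∷ γ in
      Unique σ → Good σ → BackEdge σ x y → Freeing σ x
    free-adjacent α {x} {y} {γ} uq g xy@(_ , yx) =
      -- The exchange creates no back edge; `y y` merely fills the place of one, as `y` differs from
      -- `x`.
      freeing-by y y uq g xy (++⁺ˡ α (↭-swap y x ↭-refl)) cases (⟶-irrefl yx)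
        (before-++⁺ʳ α (here (here refl)))
      where
      cases : ∀ {u v} → BackEdge (α ++ y ∷ x ∷ γ) u v → BackEdge (α ++ x ∷ y ∷ γ) u v ⊎ _
      cases (b , vu) with before-block α {x ∷ y ∷ []} {y ∷ x ∷ []}
                            (λ { (here refl) → there (here refl) ; (there (here refl)) → here refl }) b
      ... | inj₁ b′ = inj₁ (b′ , vu)
      ... | inj₂ (here (here refl)) = ⊥-elim (⟶-asym yx vu)
      ... | inj₂ (there (there ()))

    -- The back edge from `x` to `y` is the only one leaving `x` and the only one entering `y`.
    between : ∀ {σ x c y} → Unique σ → Good σ → BackEdge σ x y → Before σ x c → Before σ c y →
      x ⟶ c × c ⟶ y
    between uq g xy xc cy =
      forward uq xc (λ e → before-irrefl uq cy (target-unique g e xy)) ,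
      forward uq cy (λ e → before-irrefl uq xc (source-unique g xy e))

    module Rotation (α : List V) {x c y : V} (γ : List V) (uq : Unique (α ++ x ∷ c ∷ y ∷ γ))
      (g : Good (α ++ x ∷ c ∷ y ∷ γ)) (yx : y ⟶ x)
      (single : ∀ {d d′} → d ∈ˡ α ++ x ∷ c ∷ y ∷ γ → d′ ∈ˡ α ++ x ∷ c ∷ y ∷ γ → d ≢ d′ →
                x ⟶ d → x ⟶ d′ → d ⟶ y → d′ ⟶ y → ⊥) where

      private
        σ = α ++ x ∷ c ∷ y ∷ γ

        b-xc : Before σ x c
        b-xc = before-++⁺ʳ α (here (here refl))

        b-cy : Before σ c y
        b-cy = before-++⁺ʳ α (there (here (here refl)))

        b-xy : Before σ x y
        b-xy = before-++⁺ʳ α (here (there (here refl)))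

        xy : BackEdge σ x y
        xy = b-xy , yx

        xc : x ⟶ c
        xc = proj₁ (between uq g xy b-xc b-cy)

        cy : c ⟶ y
        cy = proj₂ (between uq g xy b-xc b-cy)

        c∈ : c ∈ˡ σ
        c∈ = before-∈ʳ b-xc

      -- A target `v` would be a second vertex, besides `c`, with `x ⟶ v ⟶ y`, against `single`.
      y-no-target : ∀ v → ¬ BackEdge σ y v
      y-no-target v (b , vy) = single c∈ (before-∈ʳ b) (before-irrefl uq (before-trans uq b-cy b)) xc
        (forward uq (before-trans uq b-xy b) λ e → before-irrefl uq b (target-unique g xy e)) cy vy

      -- A source `u` spends its one back edge on `x`, so `x ⟶ u ⟶ y`, again against `single`.
      x-no-source : ∀ u → ¬ BackEdge σ u x
      x-no-source u e@(b , xu) = single c∈ (before-∈ˡ b)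
        (≢-sym (before-irrefl uq (before-trans uq b b-xc))) xc xu cy
        (forward uq (before-trans uq b b-xy) λ e′ → before-irrefl uq b-xy (target-unique g e e′))

      -- Here `u` precedes `x`, `v` follows `y`, and c ⇒ {y, u} ⇒ {x, v} ⇒ c. Hence one of the two
      -- rotations below is always available.
      c-not-internal : ∀ {u v} → BackEdge σ u c → BackEdge σ c v → ⊥
      c-not-internal {u} {v} uc@(b , cu) cv@(b′ , vc) with ∈-++⁻ α u∈ | v∈
        where
        eq = sym (++-assoc α [ x ] (c ∷ y ∷ γ))
        u∈ = prior-∈ (α ++ [ x ]) (subst Unique eq uq) (subst (λ l → Before l u c) eq b)
        v∈ = after-∈ (α ++ [ x ]) (subst Unique eq uq) (subst (λ l → Before l c v) eq b′)
      ... | inj₂ (here refl) | _ = ⟶-asym xc cu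
      ... | inj₁ _ | here refl = ⟶-asym cy vc
      ... | inj₁ u∈α | there v∈γ = no-Δ (≢-sym (before-irrefl uq b-uy)) (before-irrefl uq b-xv) cy cu
              yx (forward uq b-yv λ e → before-irrefl uq b-cy (source-unique g cv e))
              (forward uq b-ux λ e → before-irrefl uq b-xc (target-unique g e uc))
              (forward uq b-uv λ e → before-irrefl uq b′ (target-unique g uc e)) xc vc
        where
        b-ux = before-across u∈α (here refl)
        b-uy = before-across u∈α (there (there (here refl)))
        b-uv = before-across u∈α (there (there (there v∈γ)))
        b-xv = before-++⁺ʳ α (here (there (there v∈γ)))
        b-yv = before-++⁺ʳ α (there (there (here v∈γ)))

      -- In the new block `c y x` only the pair `c`, `x` runs backward.
      rotate-left : (∀ v → ¬ BackEdge σ c v) → Freeing σ x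
      rotate-left c-no-target = freeing-by c x uq g xy
        (++⁺ˡ α (↭-trans (↭-prep c (↭-swap y x ↭-refl)) (↭-swap c x ↭-refl))) cases
        (≢-sym (⟶-irrefl xc)) (before-++⁺ʳ α (there (here (here refl))))
        where
        cases : ∀ {u v} → BackEdge (α ++ c ∷ y ∷ x ∷ γ) u v →
                BackEdge σ u v ⊎ (u ≡ c × v ≡ x × Fresh σ c x)
        cases (b , vu) with before-block α {x ∷ c ∷ y ∷ []} {c ∷ y ∷ x ∷ []}
          (λ { (here refl) → there (here refl) ; (there (here refl)) → there (there (here refl))
             ; (there (there (here refl))) → here refl }) b
        ... | inj₁ b′ = inj₁ (b′ , vu)
        ... | inj₂ (here (here refl)) = ⊥-elim (⟶-asym cy vu)
        ... | inj₂ (here (there (here refl))) = inj₂ (refl , refl , x-no-source , c-no-target)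
        ... | inj₂ (there (here (here refl))) = ⊥-elim (⟶-asym yx vu)
        ... | inj₂ (there (there (there ())))

      -- In the new block `y x c` only the pair `y`, `c` runs backward.
      rotate-right : (∀ u → ¬ BackEdge σ u c) → Freeing σ x
      rotate-right c-no-source = freeing-by y c uq g xy
        (++⁺ˡ α (↭-trans (↭-swap y x ↭-refl) (↭-prep x (↭-swap y c ↭-refl)))) cases
        (⟶-irrefl yx) (before-++⁺ʳ α (here (here refl)))
        where
        cases : ∀ {u v} → BackEdge (α ++ y ∷ x ∷ c ∷ γ) u v →
                BackEdge σ u v ⊎ (u ≡ y × v ≡ c × Fresh σ y c)
        cases (b , vu) with before-block α {x ∷ c ∷ y ∷ []} {y ∷ x ∷ c ∷ []}
          (λ { (here refl) → there (there (here refl)) ; (there (here refl)) → here refl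
             ; (there (there (here refl))) → there (here refl) }) b
        ... | inj₁ b′ = inj₁ (b′ , vu)
        ... | inj₂ (here (here refl)) = ⊥-elim (⟶-asym yx vu)
        ... | inj₂ (here (there (here refl))) = inj₂ (refl , refl , c-no-source , y-no-target)
        ... | inj₂ (there (here (here refl))) = ⊥-elim (⟶-asym xc vu)
        ... | inj₂ (there (there (there ())))

      rotation : Freeing σ x
      rotation with any? (λ u → backEdge? σ u c)
      ... | no none = rotate-right λ u e → none (u , e)
      ... | yes (_ , uc) = rotate-left λ v cv → c-not-internal uc cv

    freeing : ∀ {σ w x} → Unique σ → Good σ → x ∈ˡ σ → w ⟶ x → (∀ {v} → v ∈ˡ σ → v ≢ x → v ⟶ w) →
      Freeing σ x
    freeing {σ} {w} {x} uq g x∈ wx to-w with any? (λ y → backEdge? σ x y)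
    ... | no none = σ , ↭-refl , g , λ v e → none (v , e)
    ... | yes (y , xy@(b , yx)) with ∈-∃++ x∈
    ...   | α , β , refl with ∈-∃++ (after-∈ α uq b)
    ...     | [] , γ , refl = free-adjacent α uq g xy
    ...     | c ∷ μ , γ , refl = far μ refl
      where
      -- Both `d` and `d′` beat `w`, so x ⇒ {d, d′} ⇒ {w, y} ⇒ x.
      single : ∀ {d d′} → d ∈ˡ σ → d′ ∈ˡ σ → d ≢ d′ → x ⟶ d → x ⟶ d′ → d ⟶ y → d′ ⟶ y → ⊥
      single d∈ d′∈ d≢d′ xd xd′ dy d′y =
        no-Δ d≢d′ (≢-sym (⟶-irrefl (to-w (before-∈ʳ b) (⟶-irrefl yx)))) xd xd′
          (to-w d∈ (≢-sym (⟶-irrefl xd))) dy (to-w d′∈ (≢-sym (⟶-irrefl xd′))) d′y wx yx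
      far : ∀ ν → ν ≡ μ → Freeing σ x
      far [] refl = Rotation.rotation α γ uq g yx single
      far (d ∷ ν) refl = ⊥-elim (single (before-∈ʳ b-xc) (before-∈ʳ b-xd) (before-irrefl uq b-cd)
          (proj₁ bc) (proj₁ bd) (proj₂ bc) (proj₂ bd))
        where
        y∈ : y ∈ˡ ν ++ y ∷ γ
        y∈ = ∈-++⁺ʳ ν (here refl)
        b-xc = before-++⁺ʳ α (here (here refl))
        b-xd = before-++⁺ʳ α (here (there (here refl)))
        b-cd = before-++⁺ʳ α (there (here (here refl)))
        bc = between uq g xy b-xc (before-++⁺ʳ α (there (here (there y∈))))
        bd = between uq g xy b-xd (before-++⁺ʳ α (there (there (here y∈))))

    -- The induction that builds the ordering

    twoOuts? : ∀ L z → Dec (TwoOuts L z)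
    twoOuts? L z = any? λ a → any? λ b →
      (a ∈ˡ? L) ×-dec ((b ∈ˡ? L) ×-dec ((z ⟶? a) ×-dec ((z ⟶? b) ×-dec ¬? (a ≟ b))))

    GoodOrder : List V → Set
    GoodOrder L = ∃ λ σ → σ ↭ L × Good σ

    insert-last : ∀ {L w} → Unique (w ∷ L) → ¬ TwoOuts (w ∷ L) w → GoodOrder L → GoodOrder (w ∷ L)
    insert-last {L} {w} uq ¬two (σ , σ↭L , g) with any? (λ x → (x ∈ˡ? σ) ×-dec (w ⟶? x))
    ... | no none = σ ++ [ w ] , ↭-trans (↭-sym (∷↭∷ʳ w σ)) (↭-prep w σ↭L) ,
          -- With no out-neighbour to name, `w` itself serves as `x`: it is not in `σ` and has no
          -- back edge there.
          good-append {x = w} g w∉ (λ v∈ wv → ⊥-elim (none (_ , v∈ , wv))) λ v (b , _) → w∉ (before-∈ˡ b)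
      where
      w∉ : w ∉ˡ σ
      w∉ w∈ = head∉tail uq (∈-resp-↭ σ↭L w∈)
    ... | yes (x , x∈ , wx) = place (freeing (Unique-resp-↭ (↭-sym σ↭L) (tail-unique uq)) g x∈ wx
            λ v∈ v≢x → ⟶-flip (λ { refl → w∉ v∈ }) (v≢x ∘ only-x v∈))
      where
      w∉ : w ∉ˡ σ
      w∉ w∈ = head∉tail uq (∈-resp-↭ σ↭L w∈)
      only-x : ∀ {v} → v ∈ˡ σ → w ⟶ v → v ≡ x
      only-x {v} v∈ wv = decidable-stable (v ≟ x) λ v≢x →
        ¬two (v , x , there (∈-resp-↭ σ↭L v∈) , there (∈-resp-↭ σ↭L x∈) , wv , wx , v≢x)
      place : Freeing σ x → GoodOrder (w ∷ L)
      place (σ′ , σ′↭σ , g′ , noOut) = σ′ ++ [ w ] ,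
        ↭-trans (↭-sym (∷↭∷ʳ w σ′)) (↭-prep w (↭-trans σ′↭σ σ↭L)) ,
        good-append g′ (w∉ ∘ ∈-resp-↭ σ′↭σ) (only-x ∘ ∈-resp-↭ σ′↭σ) noOut

    -- Every out-neighbour of the last vertex `z` other than `v` is the source of a back edge into
    -- `z`, so there is at most one.
    last-dominates : ∀ {L L′ v} → L ↭ v ∷ L′ → (∀ {z} → z ∈ˡ L → TwoOuts L z) → GoodOrder L′ →
      ∃₂ λ z w → Outs L z v w
    last-dominates {L} {L′} {v} L↭ two-outs (σ , σ↭L′ , g) with initLast σ
    -- Here `L` is `v` alone, so the out-neighbour `a` would be `v` itself.
    ... | [] with two-outs (∈-resp-↭ (↭-sym L↭) (here refl))
    ...   | a , b , a∈ , b∈ , va , vb , a≢b with ∈-resp-↭ (↭-trans L↭ (↭-prep v (↭-sym σ↭L′))) a∈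
    ...     | here refl = ⊥-elim (⟶-irrefl va refl)
    last-dominates {L} {L′} {v} L↭ two-outs (σ , σ↭L′ , g) | τ ∷ʳ′ z = pick (two-outs z∈L)
      where
      L↭σ : L ↭ v ∷ τ ++ [ z ]
      L↭σ = ↭-trans L↭ (↭-prep v (↭-sym σ↭L′))
      z∈L : z ∈ˡ L
      z∈L = ∈-resp-↭ (↭-sym L↭σ) (there (∈-++⁺ʳ τ (here refl)))
      target : ∀ {u} → u ∈ˡ L → z ⟶ u → u ≡ v ⊎ BackEdge (τ ++ [ z ]) u z
      target u∈ zu with ∈-resp-↭ L↭σ u∈
      ... | here u≡v = inj₁ u≡v
      ... | there u∈σ with ∈-++⁻ τ u∈σ
      ...   | inj₁ u∈τ = inj₂ (before-across u∈τ (here refl) , zu)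
      ...   | inj₂ (here refl) = ⊥-elim (⟶-irrefl zu refl)
      outs : ∀ {b} → v ∈ˡ L → b ∈ˡ L → z ⟶ v → z ⟶ b → v ≢ b → ∃₂ λ z w → Outs L z v w
      outs {b} v∈ b∈ zv zb v≢b = z , b , record
        { z∈ = z∈L ; a∈ = v∈ ; b∈ = b∈ ; za = zv ; zb = zb ; a≢b = v≢b ; only = only-vb }
        where
        only-vb : ∀ {u} → u ∈ˡ L → z ⟶ u → u ≡ v ⊎ u ≡ b
        only-vb u∈ zu with target u∈ zu | target b∈ zb
        ... | inj₁ u≡v | _ = inj₁ u≡v
        ... | inj₂ _ | inj₁ b≡v = ⊥-elim (v≢b (sym b≡v))
        ... | inj₂ e | inj₂ e′ = inj₂ (source-unique g e e′)
      pick : TwoOuts L z → ∃₂ λ z w → Outs L z v w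
      pick (a , b , a∈ , b∈ , za , zb , a≢b) with target a∈ za | target b∈ zb
      ... | inj₁ refl | _ = outs a∈ b∈ za zb a≢b
      ... | inj₂ _ | inj₁ refl = outs b∈ a∈ zb za (≢-sym a≢b)
      ... | inj₂ e | inj₂ e′ = ⊥-elim (a≢b (source-unique g e e′))

    -- Induction is on the length because the removed vertex may be anywhere in `L`: it is `w` if
    -- some `w` has out-degree at most one, and otherwise every vertex in turn, to show it
    -- dominated.
    good-order : ∀ k L → length L ≡ k → Unique L → GoodOrder L
    good-order _ [] _ _ = [] , ↭-refl ,
      record { source-unique = λ { (() , _) } ; target-unique = λ { (() , _) } }
    good-order (suc k) L@(v ∷ _) len uq = choose (any? λ w → (w ∈ˡ? L) ×-dec ¬? (twoOuts? L w))
      where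
      recurse : ∀ {w L′} → L ↭ w ∷ L′ → GoodOrder L′
      recurse {L′ = L′} L↭ = good-order k L′ (suc-injective (trans (sym (↭-length L↭)) len))
        (tail-unique (Unique-resp-↭ L↭ uq))
      choose : Dec (∃ λ w → w ∈ˡ L × ¬ TwoOuts L w) → GoodOrder L
      choose (yes (w , w∈ , ¬two)) with extract w∈
      ... | L′ , L↭ =
            let σ , σ↭ , g = insert-last (Unique-resp-↭ L↭ uq)
                  (λ (a , b , a∈ , b∈ , rest) →
                    ¬two (a , b , ∈-resp-↭ (↭-sym L↭) a∈ , ∈-resp-↭ (↭-sym L↭) b∈ , rest))
                  (recurse L↭)
            in σ , ↭-trans σ↭ (↭-sym L↭) , g
      choose (no none) = ⊥-elim (all-dominated-absurd two-outs
          (λ v∈ → let _ , L↭ = extract v∈ in last-dominates L↭ two-outs (recurse L↭)) {v} (here refl))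
        where
        two-outs : ∀ {z} → z ∈ˡ L → TwoOuts L z
        two-outs {z} z∈ = decidable-stable (twoOuts? L z) λ ¬two → none (z , z∈ , ¬two)

    reversed-paths : ReversedPathsOfTransitive T
    reversed-paths =
      let σ , σ↭ , g = good-order n (allFin n) (length-tabulate {n = n} id) (allFin⁺ n)
      in good⇒reversed-paths (Unique-resp-↭ (↭-sym σ↭) (allFin⁺ n)) (λ v → ∈-resp-↭ (↭-sym σ↭) (∈-allFin v)) g

theorem1p2 : {n : ℕ} (T : Tournament n) → Free Δ122 (adj T) →
    (Isomorphic (adj T) T5 ⊎ Isomorphic (adj T) P7⁻ ⊎ Isomorphic (adj T) P7)
    ⊎ ReversedPathsOfTransitive T
    ⊎ (Σ (Subset n) λ X → Homogeneous (adj T) X ×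
    (InducedIso (adj T) X T5 ⊎ InducedIso (adj T) X P7))
    ⊎ (Σ (Subset n) λ D₁ → Σ (Subset n) λ D₂ →
    HomogeneousPair (adj T) D₁ D₂ × P7⁻WithDegreePartition (adj T) D₁ D₂)
theorem1p2 T free with free ∘ emb⇒contains Δ122ᵗ (adj T) | emb? T5 (adj T) | emb? P7⁻ (adj T)
... | Δ-free | yes e | _ =
      let X , hom , iso = InTournament.homogeneous-T5 T Δ-free e
      in inj₂ (inj₂ (inj₁ (X , hom , inj₁ iso)))
... | Δ-free | no _ | yes e = inj₂ (inj₂ (inj₂ (InTournament.homogeneous-P7⁻ T Δ-free e)))
... | Δ-free | no T5-free | no P7⁻-free =
      inj₂ (inj₁ (InTournament.Excluding.reversed-paths T Δ-free T5-free P7⁻-free))
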